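{- Let $G=(V,E)$ be a finite connected graph. At the end of the Explorer-Director game on $G$, the set $U$ of all visited vertices always contains a closed subset. That is: if at some point of a play $U \subseteq V$ is the set of vertices visited so far (including the token's current position $x \in U$), and from this point the Explorer has no strategy that forces the token, against every play of the Director, to reach a vertex of $V \setminus U$ after finitely many turns, then there is a closed set $W \subseteq U$.
   Context: $\mathrm{dist}(u,v)$ denotes the length of a shortest path between $u$ and $v$ in $G$. Explorer-Director game on $G$ with a given starting vertex: a token is initially at the starting vertex, which counts as visited. On each turn the Explorer names a distance $d$ such that at least one vertex of $G$ is at distance exactly $d$ from the token's current position, and then the Director moves the token to a vertex of their choice at distance exactly $d$ from the current position. The Explorer wants to maximize, and the Director to minimize, the number of distinct vertices visited by the token. The game ends when the Explorer can no longer force a visit to an unvisited vertex. Closed set: a non-empty subset $W \subseteq V$ is closed if for every $u \in W$ and every $v \in V$ there exists $y \in W$ with $\mathrm{dist}(u,v)=\mathrm{dist}(u,y)$, where distances are computed in $G$. -}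

module Defs where

open import Data.Fin.Base using (Fin)
open import Data.Fin.Properties using (_≟_; any?)
open import Data.Fin.Subset using (Subset; _∈_; _∉_; _⊆_; _∪_; ⁅_⁆; Nonempty)
open import Data.Nat.Base using (ℕ; zero; suc; _≤_; z≤n; s≤s)
open import Data.Product using (Σ; ∃; _×_; _,_; proj₁; proj₂)
open import Data.Vec.Base using (Vec; []; _∷_; head; last)
open import Data.Vec.Relation.Unary.AllPairs using (allPairs?)
open import Data.Vec.Relation.Unary.Linked using (Linked; linked?)
open import Data.Vec.Relation.Unary.Unique.Propositional using (Unique)
open import Level using (0ℓ)
open import Relation.Binary.Core using (Rel)
import Relation.Binary.Definitions as B
open import Relation.Binary.PropositionalEquality using (_≡_)
open import Relation.Nullary using (¬_; Dec; yes; no; contradiction)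
open import Relation.Nullary.Decidable using (_×-dec_; ¬?; map′)
open import Relation.Unary using (Pred; Decidable)

anyVec? : ∀ {n} k {P : Pred (Vec (Fin n) k) 0ℓ} → Decidable P → Dec (∃ P)
anyVec? zero    P? = map′ (λ p → [] , p) (λ { ([] , p) → p }) (P? [])
anyVec? (suc k) P? =
  map′ (λ { (x , xs , p) → x ∷ xs , p }) (λ { (x ∷ xs , p) → x , xs , p })
       (any? λ x → anyVec? k λ xs → P? (x ∷ xs))

Least : Pred ℕ 0ℓ → Pred ℕ 0ℓ
Least P k = P k × (∀ j → P j → k ≤ j)

least : ∀ {P : Pred ℕ 0ℓ} → Decidable P → ∀ m → P m → ∃ (Least P)
least P? zero    p = zero , p , λ _ _ → z≤n
least P? (suc m) p with P? zero
... | yes p₀ = zero , p₀ , λ _ _ → z≤n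
... | no ¬p₀ with least (λ k → P? (suc k)) m p
...   | k , pₖ , k≤ = suc k , pₖ , λ
  { zero    q → contradiction q ¬p₀
  ; (suc j) q → s≤s (k≤ j q) }

record Graph : Set₁ where
  field
    order   : ℕ
    Adj     : Rel (Fin order) 0ℓ
    adj?    : B.Decidable Adj
    adj-sym : B.Symmetric Adj
    adj-irr : B.Irreflexive _≡_ Adj

  Vertex : Set
  Vertex = Fin order

  IsPath : Vertex → Vertex → ∀ {k} → Vec Vertex (suc k) → Set
  IsPath u v p = head p ≡ u × last p ≡ v × Linked Adj p × Unique p

  -- The length of a path is its number of edges, one less than the
  -- number of its vertices.
  PathOfLength : Vertex → Vertex → ℕ → Set
  PathOfLength u v k = Σ (Vec Vertex (suc k)) (IsPath u v)

  pathOfLength? : ∀ u v → Decidable (PathOfLength u v)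
  pathOfLength? u v k = anyVec? (suc k) λ p →
    (head p ≟ u) ×-dec (last p ≟ v) ×-dec
    linked? adj? p ×-dec allPairs? (λ x y → ¬? (x ≟ y)) p

  Connected : Set
  Connected = ∀ u v → ∃ (PathOfLength u v)

module Game (G : Graph) (connected : Graph.Connected G) where

  open Graph G

  shortest : ∀ u v → ∃ (Least (PathOfLength u v))
  shortest u v = least (pathOfLength? u v) (proj₁ c) (proj₂ c)
    where c = connected u v

  dist : Vertex → Vertex → ℕ
  dist u v = proj₁ (shortest u v)

  Closed : Subset order → Set
  Closed W = Nonempty W ×
    (∀ u → u ∈ W → ∀ v → ∃ λ y → y ∈ W × dist u v ≡ dist u y)

  -- Play s x: a finite record of the turns taken so far, starting at s
  -- and leaving the token at x.
  data Play (s : Vertex) : Vertex → Set where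
    start : Play s s
    turn  : ∀ {x} → Play s x → (d : ℕ) (y : Vertex) → dist x y ≡ d → Play s y

  visited : ∀ {s x} → Play s x → Subset order
  visited {s} start    = ⁅ s ⁆
  visited (turn h _ y _) = visited h ∪ ⁅ y ⁆

  Available : Vertex → ℕ → Set
  Available x d = ∃ λ y → dist x y ≡ d

  -- Strategies may depend on the entire play so far.
  ExplorerStrategy : Vertex → Set
  ExplorerStrategy s = ∀ {x} → Play s x → ∃ (Available x)

  DirectorStrategy : Vertex → Set
  DirectorStrategy s =
    ∀ {x} → Play s x → ∀ d → Available x d → ∃ λ y → dist x y ≡ d

  module _ {s : Vertex} (σ : ExplorerStrategy s) (τ : DirectorStrategy s) where

    playTurn : ∃ (Play s) → ∃ (Play s)
    playTurn (x , h) =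
      let d , a = σ h
          y , e = τ h d a
      in y , turn h d y e

    continue : ∃ (Play s) → ℕ → ∃ (Play s)
    continue p zero    = p
    continue p (suc k) = playTurn (continue p k)

  -- The number of turns needed may depend on the Director's strategy.
  CanForceUnvisited : ∀ {s x} → Play s x → Set
  CanForceUnvisited {s} {x} h =
    ∃ λ (σ : ExplorerStrategy s) → ∀ (τ : DirectorStrategy s) →
      ∃ λ k → proj₁ (continue σ τ (x , h) k) ∉ visited h

-- While some u ∈ W and some v admit no y ∈ W with dist u y = dist u v, the
-- Explorer at u can name dist u v and push the token out of W; so u may be
-- discarded from W.  Starting from the visited set U, this either stops at a
-- closed set, or discards every vertex, in which case the Explorer can force
-- the token out of U from anywhere.
module Submission where

open import Defs
open import Data.Fin.Properties using (_≟_; any?)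
open import Data.Fin.Subset using (Subset; _∈_; _∉_; _⊆_; _⊂_; _-_)
open import Data.Fin.Subset.Induction using (⊂-wellFounded)
open import Data.Fin.Subset.Properties
  using (_∈?_; nonempty?; ⊆-refl; ⊆-trans; p─q⊆p; x∈p⇒p-x⊂p; x∈p∧x≢y⇒x∈p-y)
import Data.Nat.Properties as ℕ
open import Data.Nat.Base using (zero; suc)
open import Data.Product using (∃; ∃₂; _×_; _,_; proj₁; proj₂)
open import Data.Sum.Base using (_⊎_; inj₁; inj₂; map₁)
open import Induction.WellFounded using (Acc; acc)
open import Relation.Binary.PropositionalEquality using (_≡_; refl; sym; cong; subst)
open import Relation.Nullary using (¬_; Dec; yes; no; contradiction)
open import Relation.Nullary.Decidable using (_×-dec_; ¬?; decidable-stable)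

module Strategy (G : Graph) (connected : Graph.Connected G) where

  open Graph G
  open Game G connected

  -- Being inductive, a tree has only finite branches, which bounds each play by finitely many
  -- turns. Naming `dist x v` through `v` makes the distance available.
  data Winning (U : Subset order) (x : Vertex) : Set where
    outside : x ∉ U → Winning U x
    name    : ∀ v → (∀ y → dist x y ≡ dist x v → Winning U y) → Winning U x

  Met : Subset order → Vertex → Vertex → Set
  Met W u v = ∃ λ y → y ∈ W × dist u v ≡ dist u y

  met? : ∀ W u v → Dec (Met W u v)
  met? W u v = any? λ y → (y ∈? W) ×-dec (dist u v ℕ.≟ dist u y)

  met-or-escape : ∀ W → (∀ u → u ∈ W → ∀ v → Met W u v) ⊎
                        (∃₂ λ u v → u ∈ W × ¬ Met W u v)
  met-or-escape W with any? (λ u → any? (λ v → (u ∈? W) ×-dec ¬? (met? W u v)))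
  ... | yes escape = inj₂ escape
  ... | no ¬escape = inj₁ λ u u∈W v →
    decidable-stable (met? W u v) λ ¬met → ¬escape (u , v , u∈W , ¬met)

  closed-or-winning : ∀ {U} W → Acc _⊂_ W → (∀ y → y ∉ W → Winning U y) →
                      (∃ λ W′ → Closed W′ × W′ ⊆ W) ⊎ (∀ y → Winning U y)
  closed-or-winning {U} W (acc rec) win with met-or-escape W
  ... | inj₁ met with nonempty? W
  ...   | yes W≢∅ = inj₁ (W , (W≢∅ , met) , ⊆-refl)
  ...   | no W≡∅  = inj₂ λ y → win y λ y∈W → W≡∅ (y , y∈W)
  closed-or-winning {U} W (acc rec) win | inj₂ (u , v , u∈W , ¬met) =
    map₁ (λ (W′ , closed , W′⊆) → W′ , closed , ⊆-trans W′⊆ (p─q⊆p W _))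
         (closed-or-winning (W - u) (rec (x∈p⇒p-x⊂p u∈W)) win-u)
    where
    win-u : ∀ y → y ∉ W - u → Winning U y
    win-u y y∉ with y ≟ u
    -- A reply `z` inside `W` would itself meet `v`.
    ... | yes refl = name v λ z e → win z λ z∈W → ¬met (z , z∈W , sym e)
    ... | no y≢u   = win y λ y∈W → y∉ (x∈p∧x≢y⇒x∈p-y y∈W y≢u)

  -- A vertex may have several winning trees, and restarting from win y at
  -- every turn need not make progress; so the Explorer descends a single tree,
  -- recovering the current subtree from the play.
  module _ {U : Subset order} (win : ∀ y → Winning U y) {s : Vertex} where

    respond : ∀ {x} → Winning U x → ∀ d y → dist x y ≡ d → Winning U y
    -- Restarting at `win y` makes `tree` total: the given play need not have named the distances
    -- that the tree prescribes.
    respond     (outside _) d y e = win y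
    respond {x} (name v w)  d y e with dist x y ℕ.≟ dist x v
    ... | yes e′ = w y e′
    ... | no _   = win y

    tree : ∀ {x} → Play s x → Winning U x
    tree start          = win s
    tree (turn h d y e) = respond (tree h) d y e

    move : ∀ {x} → Winning U x → ∃ (Available x)
    move {x} (outside _) = dist x x , x , refl
    move {x} (name v _)  = dist x v , v , refl

    -- The equation lets this apply to `tree h`, which is not a constructor form. The distance test
    -- supplies its own proof `e′`.
    respond-move : ∀ {x v w} (t : Winning U x) → t ≡ name v w →
                   ∀ y (e : dist x y ≡ proj₁ (move t)) →
                   ∃ λ e′ → respond t (proj₁ (move t)) y e ≡ w y e′
    respond-move {x} {v} _ refl y e with dist x y ℕ.≟ dist x v
    ... | yes e′ = e′ , refl
    ... | no d≢  = contradiction e d≢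

    explorer : ExplorerStrategy s
    explorer h = move (tree h)

    module _ (τ : DirectorStrategy s) where

      -- `continue` adds turns at the end, while descending the tree peels off the first one.
      continue-playTurn : ∀ p k → continue explorer τ (playTurn explorer τ p) k ≡
                                  continue explorer τ p (suc k)
      continue-playTurn p zero    = refl
      continue-playTurn p (suc k) = cong (playTurn explorer τ) (continue-playTurn p k)

      -- Structural induction on `w`; the equation keeps it in step with the strategy, which sees
      -- only the play.
      escapes : ∀ {x} (w : Winning U x) (h : Play s x) → tree h ≡ w →
                ∃ λ k → proj₁ (continue explorer τ (x , h) k) ∉ U
      escapes (outside x∉U) h eq = 0 , x∉U
      escapes {x} (name v w) h eq =
        let d , a   = explorer h
            y , e   = τ h d a
            e′ , q  = respond-move (tree h) eq y e
            k , y∉U = escapes (w y e′) (turn h d y e) q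
        in suc k , subst (λ p → proj₁ p ∉ U) (continue-playTurn (x , h) k) y∉U

  winning-forces : ∀ {s x} (h : Play s x) → (∀ y → Winning (visited h) y) →
                   CanForceUnvisited h
  winning-forces h win =
    (λ {_} → explorer win) , λ τ → escapes win (λ {x} → τ {x}) _ h refl

theorem2p3 : (G : Graph) (connected : Graph.Connected G) →
    let open Graph G
        open Game G connected
    in ∀ {s x : Vertex} (h : Play s x) → ¬ CanForceUnvisited h →
       ∃ λ (W : Subset order) → Closed W × W ⊆ visited h
theorem2p3 G connected h ¬force
  -- The search starts from `W` = `visited h`, where its hypothesis is `outside` itself.
  with Strategy.closed-or-winning G connected _ (⊂-wellFounded _) (λ _ → Strategy.outside)
... | inj₁ closed = closed
... | inj₂ win    = contradiction (Strategy.winning-forces G connected h win) ¬force
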